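{- Let $f_1,f_2:\mathbb{N}^2\setminus\{(0,0)\}\to\mathbb{R}_+^*$ be two functions, with the convention $f_1(0,0)=f_2(0,0)=1$ wherever these values occur. Then $f_1,f_2$ satisfy the two conditions (1) for $i\in\{1,2\}$ and every integer $n\geq 1$, $f_i(n,0)=f_i(0,n)=1$; (2) for every $\nu_0,\nu_1,\nu_2\in\mathbb{N}$ such that $\nu_0+\nu_1+\nu_2\neq0$, $$f_1(\nu_0+\nu_2,\nu_1)\,f_2(\nu_0,\nu_2)=f_2(\nu_0+\nu_1,\nu_2)\,f_1(\nu_0,\nu_1);$$ if and only if there exists a sequence $D=\{D_i\}_{i\geq1}\subset\mathbb{R}_+^*$ with $D_1=1$ such that, for all $(\nu_1,\nu_2)\in\mathbb{N}^2\setminus\{(0,0)\}$, $$f_1(\nu_1,\nu_2)=f_2(\nu_1,\nu_2)=\frac{[\nu_1+\nu_2]_D!}{[\nu_1]_D!\,[\nu_2]_D!}.$$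
   Context: $\mathbb{N}=\{0,1,2,\dots\}$ and $\mathbb{R}_+^*=\{x\in\mathbb{R}:x>0\}$. For a sequence $D=\{D_i\}_{i\ge1}$, $[n]_D!=D_nD_{n-1}\cdots D_1$ for $n>0$ and $[0]_D!=1$. -}

module Defs where

open import Data.Nat.Base as ℕ using (ℕ; zero; suc; NonZero)
import Data.Nat.Properties as ℕ
open import Data.Irrelevant using ([_])
open import Data.Product using (∃; _×_; _,_)
open import Data.Rational.Base as ℚ
  using (ℚ; 0ℚ; 1ℚ; _+_; _*_; -_; _-_; 1/_; ∣_∣; _≤_; _<_; Positive; positive)
import Data.Rational.Properties as ℚ
open import Data.Refinement using (Refinement-syntax; _,_)
open import Algebra.Properties.Ring ℚ.+-*-ring
  using (x[y-z]≈xy-xz; [y-z]x≈yx-zx; ⁻¹-anti-homo-//)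
open import Relation.Binary.PropositionalEquality
open import Relation.Nullary using (yes; no; contradiction)

Eventually : (ℕ → Set) → Set
Eventually P = ∃ λ N → ∀ n → N ℕ.≤ n → P n

IsCauchy : (ℕ → ℚ) → Set
IsCauchy x = ∀ ε .{{_ : Positive ε}} →
  ∃ λ N → ∀ m n → N ℕ.≤ m → N ℕ.≤ n → ∣ x m - x n ∣ < ε

-- Real numbers are Cauchy sequences of rationals, equal when _≈ᴿ_ holds (not _≡_).
record ℝ : Set where
  constructor mkℝ
  field
    seq    : ℕ → ℚ
    cauchy : IsCauchy seq

open ℝ public

infix 4 _≈ᴿ_ _<ᴿ_

_≈ᴿ_ : ℝ → ℝ → Set
x ≈ᴿ y = ∀ ε .{{_ : Positive ε}} → Eventually λ n → ∣ seq x n - seq y n ∣ < ε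

_<ᴿ_ : ℝ → ℝ → Set
x <ᴿ y = ∃ λ ε → Positive ε × Eventually λ n → seq x n + ε ≤ seq y n

fromℚ : ℚ → ℝ
fromℚ q = mkℝ (λ _ → q) λ ε → 0 , λ _ _ _ _ →
  subst (_< ε) (sym (cong ∣_∣ (ℚ.+-inverseʳ q))) (ℚ.positive⁻¹ ε)

0ℝ 1ℝ : ℝ
0ℝ = fromℚ 0ℚ
1ℝ = fromℚ 1ℚ

⊔-split : ∀ m n {o} → m ℕ.⊔ n ℕ.≤ o → m ℕ.≤ o × n ℕ.≤ o
⊔-split m n m⊔n≤o = ℕ.m⊔n≤o⇒m≤o m n m⊔n≤o , ℕ.m⊔n≤o⇒n≤o m n m⊔n≤o

infixr 3 _and_

_and_ : ∀ {P Q} → Eventually P → Eventually Q → Eventually (λ n → P n × Q n)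
(M , p) and (N , q) = M ℕ.⊔ N , λ n M⊔N≤n →
  let M≤n , N≤n = ⊔-split M N M⊔N≤n in p n M≤n , q n N≤n

eventually-map : ∀ {P Q : ℕ → Set} → (∀ {n} → P n → Q n) → Eventually P → Eventually Q
eventually-map f (N , p) = N , λ n N≤n → f (p n N≤n)

p-q+q≡p : ∀ p q → (p - q) + q ≡ p
p-q+q≡p p q = trans (ℚ.+-assoc p (- q) q)
  (trans (cong (p +_) (ℚ.+-inverseˡ q)) (ℚ.+-identityʳ p))

telescope : ∀ p q r → (p - q) + (q - r) ≡ p - r
telescope p q r = trans (sym (ℚ.+-assoc (p - q) q (- r))) (cong (_- r) (p-q+q≡p p q))

cancel-1/ : ∀ p q .{{_ : ℚ.NonZero p}} → p * (1/ p * q) ≡ q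
cancel-1/ p q = trans (sym (ℚ.*-assoc p (1/ p) q))
  (trans (cong (_* q) (ℚ.*-inverseʳ p)) (ℚ.*-identityˡ q))

bound : ∀ x → ∃ λ B → Positive B × Eventually λ n → ∣ seq x n ∣ ≤ B
bound x with N , close ← cauchy x 1ℚ =
  1ℚ + ∣ xₙ ∣ , ℚ.pos+nonNeg⇒pos 1ℚ ∣ xₙ ∣ {{ℚ.∣-∣-nonNeg xₙ}} , N , bounded
  where
  xₙ = seq x N

  bounded : ∀ n → N ℕ.≤ n → ∣ seq x n ∣ ≤ 1ℚ + ∣ xₙ ∣
  bounded n N≤n = begin
    ∣ seq x n ∣                ≡⟨ cong ∣_∣ (p-q+q≡p (seq x n) xₙ) ⟨
    ∣ (seq x n - xₙ) + xₙ ∣    ≤⟨ ℚ.∣p+q∣≤∣p∣+∣q∣ (seq x n - xₙ) xₙ ⟩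
    ∣ seq x n - xₙ ∣ + ∣ xₙ ∣  ≤⟨ ℚ.+-monoˡ-≤ ∣ xₙ ∣ (ℚ.<⇒≤ (close n N N≤n ℕ.≤-refl)) ⟩
    1ℚ + ∣ xₙ ∣                ∎
    where open ℚ.≤-Reasoning

*-close : ∀ A B .{{_ : Positive A}} .{{_ : Positive B}} {a b c d δ} →
          ∣ a ∣ ≤ A → ∣ d ∣ ≤ B → ∣ a - c ∣ < δ → ∣ b - d ∣ < δ →
          ∣ a * b - c * d ∣ < (A + B) * δ
*-close A B {a} {b} {c} {d} {δ} a≤A d≤B ac bd = begin-strict
  ∣ a * b - c * d ∣                    ≡⟨ cong ∣_∣ (telescope (a * b) (a * d) (c * d)) ⟨
  ∣ (a * b - a * d) + (a * d - c * d) ∣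
    ≡⟨ cong ∣_∣ (cong₂ _+_ (x[y-z]≈xy-xz a b d) ([y-z]x≈yx-zx d a c)) ⟨
  ∣ a * (b - d) + (a - c) * d ∣        ≤⟨ ℚ.∣p+q∣≤∣p∣+∣q∣ (a * (b - d)) ((a - c) * d) ⟩
  ∣ a * (b - d) ∣ + ∣ (a - c) * d ∣    ≡⟨ cong (λ e → ∣ a * (b - d) ∣ + ∣ e ∣) (ℚ.*-comm (a - c) d) ⟩
  ∣ a * (b - d) ∣ + ∣ d * (a - c) ∣    ≤⟨ ℚ.+-mono-≤ (scale a (b - d) a≤A) (scale d (a - c) d≤B) ⟩
  A * ∣ b - d ∣ + B * ∣ a - c ∣        <⟨ ℚ.+-mono-< (ℚ.*-monoʳ-<-pos A bd) (ℚ.*-monoʳ-<-pos B ac) ⟩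
  A * δ + B * δ                        ≡⟨ ℚ.*-distribʳ-+ δ A B ⟨
  (A + B) * δ                          ∎
  where
  open ℚ.≤-Reasoning
  scale : ∀ p q {C} → ∣ p ∣ ≤ C → ∣ p * q ∣ ≤ C * ∣ q ∣
  scale p q p≤C = ℚ.≤-trans (ℚ.≤-reflexive (ℚ.∣p*q∣≡∣p∣*∣q∣ p q))
    (ℚ.*-monoʳ-≤-nonNeg ∣ q ∣ {{ℚ.∣-∣-nonNeg q}} p≤C)

infixl 7 _*ᴿ_

_*ᴿ_ : ℝ → ℝ → ℝ
x *ᴿ y = mkℝ (λ n → seq x n * seq y n) *-cauchy
  where
  *-cauchy : IsCauchy (λ n → seq x n * seq y n)
  *-cauchy ε with bound x | bound y
  ... | A , A-pos , N₁ , x≤A | B , B-pos , N₂ , y≤B = go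
    where
    instance
      _ = A-pos
      _ = B-pos
      A+B-pos : Positive (A + B)
      A+B-pos = ℚ.pos+pos⇒pos A B
      A+B-nonZero : ℚ.NonZero (A + B)
      A+B-nonZero = ℚ.pos⇒nonZero (A + B)
    δ : ℚ
    δ = 1/ (A + B) * ε
    instance
      δ-pos : Positive δ
      δ-pos = ℚ.pos*pos⇒pos (1/ (A + B)) {{ℚ.1/pos⇒pos (A + B)}} ε
    go : ∃ λ N → ∀ m n → N ℕ.≤ m → N ℕ.≤ n →
         ∣ seq x m * seq y m - seq x n * seq y n ∣ < ε
    go with N₃ , cx ← cauchy x δ | N₄ , cy ← cauchy y δ =
      N₁ ℕ.⊔ N₂ ℕ.⊔ (N₃ ℕ.⊔ N₄) , λ m n N≤m N≤n →
      let N₁₂≤m , N₃₄≤m = ⊔-split (N₁ ℕ.⊔ N₂) (N₃ ℕ.⊔ N₄) N≤m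
          N₁₂≤n , N₃₄≤n = ⊔-split (N₁ ℕ.⊔ N₂) (N₃ ℕ.⊔ N₄) N≤n
          N₁≤m , _      = ⊔-split N₁ N₂ N₁₂≤m
          _ , N₂≤n      = ⊔-split N₁ N₂ N₁₂≤n
          N₃≤m , N₄≤m   = ⊔-split N₃ N₄ N₃₄≤m
          N₃≤n , N₄≤n   = ⊔-split N₃ N₄ N₃₄≤n
      in subst (∣ seq x m * seq y m - seq x n * seq y n ∣ <_) (cancel-1/ (A + B) ε)
           (*-close A B (x≤A m N₁≤m) (y≤B n N₂≤n) (cx m n N₃≤m N₃≤n) (cy m n N₄≤m N₄≤n))

*-positive : ∀ x y → 0ℝ <ᴿ x → 0ℝ <ᴿ y → 0ℝ <ᴿ x *ᴿ y
*-positive x y (ε , ε-pos , x≥ε) (δ , δ-pos , y≥δ) =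
  ε * δ , ℚ.pos*pos⇒pos ε δ , eventually-map step (x≥ε and y≥δ)
  where
  instance
    _ = ε-pos
    _ = δ-pos
  step : ∀ {n} → 0ℚ + ε ≤ seq x n × 0ℚ + δ ≤ seq y n → 0ℚ + ε * δ ≤ seq x n * seq y n
  step {n} (ε≤x , δ≤y) = begin
    0ℚ + ε * δ         ≡⟨ ℚ.+-identityˡ (ε * δ) ⟩
    ε * δ              ≤⟨ ℚ.*-monoˡ-≤-nonNeg ε {{ℚ.pos⇒nonNeg ε}} δ≤y′ ⟩
    ε * seq y n        ≤⟨ ℚ.*-monoʳ-≤-nonNeg (seq y n) {{y≥0}} ε≤x′ ⟩
    seq x n * seq y n  ∎
    where
    open ℚ.≤-Reasoning
    ε≤x′ : ε ≤ seq x n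
    ε≤x′ = subst (_≤ seq x n) (ℚ.+-identityˡ ε) ε≤x
    δ≤y′ : δ ≤ seq y n
    δ≤y′ = subst (_≤ seq y n) (ℚ.+-identityˡ δ) δ≤y
    y≥0 : ℚ.NonNegative (seq y n)
    y≥0 = ℚ.nonNegative (ℚ.≤-trans (ℚ.<⇒≤ (ℚ.positive⁻¹ δ)) δ≤y′)

-- The value at 0 is irrelevant: a positive real has eventually nonzero terms.
recip : ℚ → ℚ
recip q with q ℚ.≟ 0ℚ
... | yes _  = 0ℚ
... | no q≢0 = (1/ q) {{ℚ.≢-nonZero q≢0}}

recip-inverse : ∀ {q} → 0ℚ < q → q * recip q ≡ 1ℚ
recip-inverse {q} q>0 with q ℚ.≟ 0ℚ
... | yes q≡0 = contradiction (sym q≡0) (ℚ.<⇒≢ q>0)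
... | no q≢0  = ℚ.*-inverseʳ q {{ℚ.≢-nonZero q≢0}}

recip-positive : ∀ {q} → 0ℚ < q → Positive (recip q)
recip-positive {q} q>0 with q ℚ.≟ 0ℚ
... | yes q≡0 = contradiction (sym q≡0) (ℚ.<⇒≢ q>0)
... | no _    = ℚ.1/pos⇒pos q {{positive q>0}}

recip-difference : ∀ {p q} → 0ℚ < p → 0ℚ < q →
                   p * q * (recip p - recip q) ≡ q - p
recip-difference {p} {q} p>0 q>0 = begin
  p * q * (recip p - recip q)          ≡⟨ x[y-z]≈xy-xz (p * q) (recip p) (recip q) ⟩
  p * q * recip p - p * q * recip q    ≡⟨ cong₂ _-_ left right ⟩
  q - p                                ∎
  where
  open ≡-Reasoning
  right : ∀ {p} → p * q * recip q ≡ p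
  right {p} = trans (ℚ.*-assoc p q (recip q))
    (trans (cong (p *_) (recip-inverse q>0)) (ℚ.*-identityʳ p))
  left : p * q * recip p ≡ q
  left = trans (cong (_* recip p) (ℚ.*-comm p q)) (trans (ℚ.*-assoc q p (recip p))
    (trans (cong (q *_) (recip-inverse p>0)) (ℚ.*-identityʳ q)))

recip-close : ∀ {ε p q δ} .{{_ : Positive ε}} → ε ≤ p → ε ≤ q →
              ∣ p - q ∣ < ε * ε * δ → ∣ recip p - recip q ∣ < δ
recip-close {ε} {p} {q} {δ} ε≤p ε≤q close = ℚ.*-cancelˡ-<-nonNeg (ε * ε) (begin-strict
  ε * ε * ∣ recip p - recip q ∣      ≤⟨ ℚ.*-monoʳ-≤-nonNeg ∣ d ∣ {{ℚ.∣-∣-nonNeg d}} εε≤pq ⟩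
  p * q * ∣ d ∣                      ≡⟨ cong (_* ∣ d ∣) (ℚ.0≤p⇒∣p∣≡p (ℚ.<⇒≤ pq>0)) ⟨
  ∣ p * q ∣ * ∣ d ∣                  ≡⟨ ℚ.∣p*q∣≡∣p∣*∣q∣ (p * q) d ⟨
  ∣ p * q * d ∣                      ≡⟨ cong ∣_∣ (recip-difference p>0 q>0) ⟩
  ∣ q - p ∣                          ≡⟨ ∣-∣-comm ⟩
  ∣ p - q ∣                          <⟨ close ⟩
  ε * ε * δ                          ∎)
  where
  open ℚ.≤-Reasoning
  instance
    _ = ℚ.pos⇒nonNeg ε
    εε-pos : Positive (ε * ε)
    εε-pos = ℚ.pos*pos⇒pos ε ε
    εε-nonNeg : ℚ.NonNegative (ε * ε)
    εε-nonNeg = ℚ.pos⇒nonNeg (ε * ε)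
  d = recip p - recip q
  p>0 : 0ℚ < p
  p>0 = ℚ.<-≤-trans (ℚ.positive⁻¹ ε) ε≤p
  q>0 : 0ℚ < q
  q>0 = ℚ.<-≤-trans (ℚ.positive⁻¹ ε) ε≤q
  εε≤pq : ε * ε ≤ p * q
  εε≤pq = ℚ.≤-trans (ℚ.*-monoˡ-≤-nonNeg ε ε≤q)
    (ℚ.*-monoʳ-≤-nonNeg q {{ℚ.nonNegative (ℚ.<⇒≤ q>0)}} ε≤p)
  pq>0 : 0ℚ < p * q
  pq>0 = ℚ.<-≤-trans (ℚ.positive⁻¹ (ε * ε)) εε≤pq
  ∣-∣-comm : ∣ q - p ∣ ≡ ∣ p - q ∣
  ∣-∣-comm = trans (sym (ℚ.∣-p∣≡∣p∣ (q - p))) (cong ∣_∣ (⁻¹-anti-homo-// q p))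

recipᴿ : ∀ x → 0ℝ <ᴿ x → ℝ
recipᴿ x (ε , ε-pos , N₁ , x≥ε) = mkℝ (λ n → recip (seq x n)) recip-cauchy
  where
  instance
    _ = ε-pos
    _ = ℚ.pos*pos⇒pos ε ε
  ε≤x : ∀ n → N₁ ℕ.≤ n → ε ≤ seq x n
  ε≤x n N₁≤n = subst (_≤ seq x n) (ℚ.+-identityˡ ε) (x≥ε n N₁≤n)
  recip-cauchy : IsCauchy (λ n → recip (seq x n))
  recip-cauchy δ with N₂ , close ← cauchy x (ε * ε * δ) {{ℚ.pos*pos⇒pos (ε * ε) δ}} =
    N₁ ℕ.⊔ N₂ , λ m n N≤m N≤n →
    let N₁≤m , N₂≤m = ⊔-split N₁ N₂ N≤m
        N₁≤n , N₂≤n = ⊔-split N₁ N₂ N≤n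
    in recip-close (ε≤x m N₁≤m) (ε≤x n N₁≤n) (close m n N₂≤m N₂≤n)

recipᴿ-positive : ∀ x (x>0 : 0ℝ <ᴿ x) → 0ℝ <ᴿ recipᴿ x x>0
recipᴿ-positive x (ε , ε-pos , x≥ε) with B , B-pos , x≤B ← bound x =
  recip B , recip-positive B>0 , eventually-map step (x≥ε and x≤B)
  where
  instance
    _ = ε-pos
    _ = B-pos
  B>0 : 0ℚ < B
  B>0 = ℚ.positive⁻¹ B
  step : ∀ {n} → 0ℚ + ε ≤ seq x n × ∣ seq x n ∣ ≤ B → 0ℚ + recip B ≤ recip (seq x n)
  step {n} (ε≤q , q≤B) = subst (_≤ recip q) (sym (ℚ.+-identityˡ (recip B)))
    (ℚ.*-cancelˡ-≤-pos q {{positive q>0}} (begin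
      q * recip B  ≤⟨ ℚ.*-monoʳ-≤-nonNeg (recip B) {{recipB≥0}} (ℚ.≤-trans q≤∣q∣ q≤B) ⟩
      B * recip B  ≡⟨ recip-inverse B>0 ⟩
      1ℚ           ≡⟨ recip-inverse q>0 ⟨
      q * recip q  ∎))
    where
    open ℚ.≤-Reasoning
    q = seq x n
    q>0 : 0ℚ < q
    q>0 = ℚ.<-≤-trans (ℚ.positive⁻¹ ε) (subst (_≤ q) (ℚ.+-identityˡ ε) ε≤q)
    q≤∣q∣ : q ≤ ∣ q ∣
    q≤∣q∣ = ℚ.≤-reflexive (sym (ℚ.0≤p⇒∣p∣≡p (ℚ.<⇒≤ q>0)))
    recipB≥0 : ℚ.NonNegative (recip B)
    recipB≥0 = ℚ.pos⇒nonNeg (recip B) {{recip-positive B>0}}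

record ℝ₊* : Set where
  constructor _,_
  field
    value   : ℝ
    value>0 : 0ℝ <ᴿ value

open ℝ₊* public using (value; value>0)

infix  4 _≈_
infixl 7 _·_ _÷_

_≈_ : ℝ₊* → ℝ₊* → Set
x ≈ y = value x ≈ᴿ value y

𝟙 : ℝ₊*
𝟙 = 1ℝ , 1ℚ , _ , 0 , λ _ _ → ℚ.≤-reflexive (ℚ.+-identityˡ 1ℚ)

_·_ : ℝ₊* → ℝ₊* → ℝ₊*
(x , x>0) · (y , y>0) = x *ᴿ y , *-positive x y x>0 y>0

_÷_ : ℝ₊* → ℝ₊* → ℝ₊*
x ÷ (y , y>0) = x · (recipᴿ y y>0 , recipᴿ-positive y y>0)

ℕ²∖0 : Set
ℕ²∖0 = [ ν ∈ ℕ × ℕ ∣ ν ≢ (0 , 0) ]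

-- The extension of f to ℕ² by the convention f(0,0) = 1.
_⟨_,_⟩ : (ℕ²∖0 → ℝ₊*) → ℕ → ℕ → ℝ₊*
f ⟨ zero  , zero  ⟩ = 𝟙
f ⟨ zero  , suc n ⟩ = f ((zero , suc n) , [ (λ ()) ])
f ⟨ suc m , n     ⟩ = f ((suc m , n) , [ (λ ()) ])

-- Indexed by i ≥ 1.
Sequence : Set
Sequence = (i : ℕ) .{{_ : NonZero i}} → ℝ₊*

[_]_! : ℕ → Sequence → ℝ₊*
[ zero  ] D ! = 𝟙
[ suc n ] D ! = D (suc n) · [ n ] D !

{-# OPTIONS --safe #-}

-- Condition (2) at ν₀ = 0 reads f₁(c,b) = f₂(b,c), and then at ν₂ = 1 it reads
-- f₁(b+1,a) f₂(b,1) = f₂(b+a,1) f₁(b,a).  With D_{n+1} = f₂(n,1), induction on b turns this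
-- into f₁(b,a) [b]! [a]! = [b+a]!, whose right-hand side is symmetric, so f₁ = f₂.
-- Only the abelian group structure of ℝ₊* is involved.

module Submission where

open import Algebra.Bundles using (AbelianGroup; CommutativeMonoid)
import Algebra.Consequences.Setoid as Consequences
import Algebra.Properties.CommutativeSemigroup as CommutativeSemigroupProperties
import Algebra.Properties.Group as GroupProperties
open import Defs
open import Data.Nat.Base as ℕ using (ℕ; zero; suc; _+_; _≥_; z≤n; s≤s)
import Data.Nat.Properties as ℕ
open import Data.Product using (∃; _×_; _,_; proj₁; proj₂)
open import Data.Rational.Base as ℚ using (ℚ; Positive; ½; 0ℚ; 1ℚ; ∣_∣)
import Data.Rational.Properties as ℚ
open import Algebra.Properties.Ring ℚ.+-*-ring using (⁻¹-anti-homo-//)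
open import Function.Bundles using (_⇔_; mk⇔)
open import Level using (0ℓ)
open import Relation.Binary.PropositionalEquality as ≡
  using (_≡_; _≢_; cong; subst)

-- Abelian groups from commutative monoids with inverses.

module _ {c ℓ} (M : CommutativeMonoid c ℓ) where
  open CommutativeMonoid M
    renaming (Carrier to C; _≈_ to _≋_)

  -- Congruence of the inverse comes from uniqueness of inverses, so no estimate on reciprocals of
  -- close reals has to be made later.
  commutativeMonoid+inverse⇒abelianGroup :
    (_⁻¹ : C → C) → (∀ x → x ∙ x ⁻¹ ≋ ε) → AbelianGroup c ℓ
  commutativeMonoid+inverse⇒abelianGroup _⁻¹ inverseʳ = record
    { isAbelianGroup = record
      { isGroup = record
        { isMonoid = isMonoid
        ; inverse  = comm∧invʳ⇒inv comm inverseʳ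
        ; ⁻¹-cong  = λ {x} {y} x≋y →
            assoc∧id∧invʳ⇒invˡ-unique ∙-cong assoc identity inverseʳ (x ⁻¹) y
              (trans (∙-congˡ (sym x≋y)) (trans (comm (x ⁻¹) x) (inverseʳ x)))
        }
      ; comm = comm
      }
    }
    where open Consequences setoid

-- Multinomial coefficients in an abelian group.

module Multinomial {c ℓ} (G : AbelianGroup c ℓ) where
  open AbelianGroup G renaming (Carrier to C; _≈_ to _≋_)
  open GroupProperties group using (x≈z//y; //-rightDividesˡ; ∙-cancelʳ)
  open import Relation.Binary.Reasoning.Setoid setoid

  Exchange : (f₁ f₂ : ℕ → ℕ → C) → Set ℓ
  Exchange f₁ f₂ = ∀ a b c → f₁ (a + c) b ∙ f₂ a c ≋ f₂ (a + b) c ∙ f₁ a b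

  Quotient : (F : ℕ → C) (f : ℕ → ℕ → C) → Set ℓ
  Quotient F f = ∀ a b → f a b ≋ F (a + b) ∙ (F a ∙ F b) ⁻¹

  module _ {f₁ f₂ : ℕ → ℕ → C} (f₁-0ˡ : ∀ n → f₁ 0 n ≋ ε) (f₂-0ˡ : ∀ n → f₂ 0 n ≋ ε)
           (exchange : Exchange f₁ f₂) where

    exchange⇒flip : ∀ b c → f₁ c b ≋ f₂ b c
    exchange⇒flip b c = begin
      f₁ c b           ≈⟨ identityʳ _ ⟨
      f₁ c b ∙ ε       ≈⟨ ∙-congˡ (f₂-0ˡ c) ⟨
      f₁ c b ∙ f₂ 0 c  ≈⟨ exchange 0 b c ⟩
      f₂ b c ∙ f₁ 0 b  ≈⟨ ∙-congˡ (f₁-0ˡ b) ⟩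
      f₂ b c ∙ ε       ≈⟨ identityʳ _ ⟩
      f₂ b c           ∎

    module _ {F : ℕ → C} (F-0 : F 0 ≋ ε) (F-suc : ∀ n → F (suc n) ≋ f₂ n 1 ∙ F n) where

      -- Denominators are cleared so that the induction handles products only. `exchange` at `c = 1`
      -- trades `f₂ b 1`, the last factor of `F (suc b)`, for `f₂ (b + a) 1`, the last factor of
      -- `F (suc b + a)`.
      exchange⇒multinomial : ∀ b a → f₁ b a ∙ (F b ∙ F a) ≋ F (b + a)
      exchange⇒multinomial zero a = begin
        f₁ 0 a ∙ (F 0 ∙ F a)  ≈⟨ ∙-cong (f₁-0ˡ a) (∙-congʳ F-0) ⟩
        ε ∙ (ε ∙ F a)         ≈⟨ identityˡ _ ⟩
        ε ∙ F a               ≈⟨ identityˡ _ ⟩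
        F a                   ∎
      exchange⇒multinomial (suc b) a = begin
        f₁ (suc b) a ∙ (F (suc b) ∙ F a)
          -- `exchange` at `c = 1` speaks of `b + 1`, which does not reduce to `suc b`.
          ≈⟨ ∙-cong (reflexive (cong (λ n → f₁ n a) (ℕ.+-comm 1 b))) (∙-congʳ (F-suc b)) ⟩
        f₁ (b + 1) a ∙ (f₂ b 1 ∙ F b ∙ F a)
          ≈⟨ regroup (f₁ (b + 1) a) (f₂ b 1) (F b) (F a) ⟩
        f₁ (b + 1) a ∙ f₂ b 1 ∙ (F b ∙ F a)
          ≈⟨ ∙-congʳ (exchange b a 1) ⟩
        f₂ (b + a) 1 ∙ f₁ b a ∙ (F b ∙ F a)
          ≈⟨ assoc _ _ _ ⟩
        f₂ (b + a) 1 ∙ (f₁ b a ∙ (F b ∙ F a))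
          ≈⟨ ∙-congˡ (exchange⇒multinomial b a) ⟩
        f₂ (b + a) 1 ∙ F (b + a)
          ≈⟨ F-suc (b + a) ⟨
        F (suc b + a) ∎
        where
        regroup : ∀ w x y z → w ∙ (x ∙ y ∙ z) ≋ w ∙ x ∙ (y ∙ z)
        regroup w x y z = trans (∙-congˡ (assoc x y z)) (sym (assoc w x (y ∙ z)))

      -- The induction gives the formula for `f₁`; the flip carries it to `f₂` with the arguments
      -- swapped, and the quotient is symmetric in them.
      exchange⇒quotient : ∀ a b →
        f₁ a b ≋ f₂ a b × f₂ a b ≋ F (a + b) ∙ (F a ∙ F b) ⁻¹
      exchange⇒quotient a b = trans f₁≋quotient (sym f₂≋quotient) , f₂≋quotient
        where
        quotient : Quotient F f₁
        quotient a b = x≈z//y _ _ _ (exchange⇒multinomial a b)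
        f₁≋quotient = quotient a b
        f₂≋quotient : f₂ a b ≋ F (a + b) ∙ (F a ∙ F b) ⁻¹
        f₂≋quotient = begin
          f₂ a b                       ≈⟨ exchange⇒flip a b ⟨
          f₁ b a                       ≈⟨ quotient b a ⟩
          F (b + a) ∙ (F b ∙ F a) ⁻¹
            ≈⟨ ∙-cong (reflexive (cong F (ℕ.+-comm b a))) (⁻¹-cong (comm (F b) (F a))) ⟩
          F (a + b) ∙ (F a ∙ F b) ⁻¹  ∎

  multinomial : ∀ {F f} → Quotient F f → ∀ a b → f a b ∙ (F a ∙ F b) ≋ F (a + b)
  multinomial quotient a b = trans (∙-congʳ (quotient a b)) (//-rightDividesˡ _ _)

  quotient⇒0ʳ : ∀ {F f} → F 0 ≋ ε → Quotient F f → ∀ n → f n 0 ≋ ε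
  quotient⇒0ʳ {F} {f} F-0 quotient n = ∙-cancelʳ (F n ∙ F 0) _ _ (begin
    f n 0 ∙ (F n ∙ F 0)  ≈⟨ multinomial quotient n 0 ⟩
    F (n + 0)            ≡⟨ cong F (ℕ.+-identityʳ n) ⟩
    F n                  ≈⟨ identityʳ _ ⟨
    F n ∙ ε              ≈⟨ ∙-congˡ F-0 ⟨
    F n ∙ F 0            ≈⟨ identityˡ _ ⟨
    ε ∙ (F n ∙ F 0)      ∎)

  quotient⇒0ˡ : ∀ {F f} → F 0 ≋ ε → Quotient F f → ∀ n → f 0 n ≋ ε
  quotient⇒0ˡ {F} {f} F-0 quotient n = ∙-cancelʳ (F 0 ∙ F n) _ _ (begin
    f 0 n ∙ (F 0 ∙ F n)  ≈⟨ multinomial quotient 0 n ⟩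
    F n                  ≈⟨ identityˡ _ ⟨
    ε ∙ F n              ≈⟨ ∙-congʳ F-0 ⟨
    F 0 ∙ F n            ≈⟨ identityˡ _ ⟨
    ε ∙ (F 0 ∙ F n)      ∎)

  -- The factor `F (a + b)` cancels between the two binomials, leaving a trinomial coefficient.
  -- Separate `f` and `g` let the lemma serve both sides of `Exchange`, where `f₁` and `f₂` swap
  -- roles.
  trinomial : ∀ {F f g} → Quotient F f → Quotient F g → ∀ a b c →
              f (a + b) c ∙ g a b ∙ (F a ∙ F b ∙ F c) ≋ F (a + b + c)
  trinomial {F} {f} {g} f-quotient g-quotient a b c = begin
    f (a + b) c ∙ g a b ∙ (F a ∙ F b ∙ F c)    ≈⟨ assoc _ _ _ ⟩
    f (a + b) c ∙ (g a b ∙ (F a ∙ F b ∙ F c))  ≈⟨ ∙-congˡ (assoc _ _ _) ⟨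
    f (a + b) c ∙ (g a b ∙ (F a ∙ F b) ∙ F c)
      ≈⟨ ∙-congˡ (∙-congʳ (multinomial g-quotient a b)) ⟩
    f (a + b) c ∙ (F (a + b) ∙ F c)            ≈⟨ multinomial f-quotient (a + b) c ⟩
    F (a + b + c)                              ∎

  -- Both sides are the same trinomial coefficient, with `b` and `c` listed in opposite orders.
  quotient⇒exchange : ∀ {F f₁ f₂} → Quotient F f₁ → Quotient F f₂ → Exchange f₁ f₂
  quotient⇒exchange {F} {f₁} {f₂} f₁-quotient f₂-quotient a b c =
    ∙-cancelʳ (F a ∙ F c ∙ F b) _ _ (begin
      f₁ (a + c) b ∙ f₂ a c ∙ (F a ∙ F c ∙ F b)  ≈⟨ trinomial f₁-quotient f₂-quotient a c b ⟩
      F (a + c + b)                              ≡⟨ cong F (ℕ-xy∙z≈xz∙y a c b) ⟩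
      F (a + b + c)                              ≈⟨ trinomial f₂-quotient f₁-quotient a b c ⟨
      f₂ (a + b) c ∙ f₁ a b ∙ (F a ∙ F b ∙ F c)  ≈⟨ ∙-congˡ (xy∙z≈xz∙y _ _ _) ⟩
      f₂ (a + b) c ∙ f₁ a b ∙ (F a ∙ F c ∙ F b)  ∎)
    where
    open CommutativeSemigroupProperties commutativeSemigroup using (xy∙z≈xz∙y)
    open CommutativeSemigroupProperties ℕ.+-commutativeSemigroup
      using () renaming (xy∙z≈xz∙y to ℕ-xy∙z≈xz∙y)

-- The multiplicative group of positive reals.

∣p-q∣≡∣q-p∣ : ∀ p q → ∣ p ℚ.- q ∣ ≡ ∣ q ℚ.- p ∣
∣p-q∣≡∣q-p∣ p q = ≡.trans (≡.sym (ℚ.∣-p∣≡∣p∣ (p ℚ.- q))) (cong ∣_∣ (⁻¹-anti-homo-// p q))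

-- Eventual agreement is the form that inverses require: early terms of a positive real may vanish,
-- and there `recip` has its default value.
≈ᴿ-reflexive : ∀ x y → Eventually (λ n → seq x n ≡ seq y n) → x ≈ᴿ y
≈ᴿ-reflexive x y x≡y ε = eventually-map close x≡y
  where
  close : ∀ {p q} → p ≡ q → ∣ p ℚ.- q ∣ ℚ.< ε
  close {p} ≡.refl = subst (ℚ._< ε) (≡.sym (cong ∣_∣ (ℚ.+-inverseʳ p))) (ℚ.positive⁻¹ ε)

≈ᴿ-sym : ∀ x y → x ≈ᴿ y → y ≈ᴿ x
≈ᴿ-sym x y x≈y ε = eventually-map
  (λ {n} → subst (ℚ._< ε) (∣p-q∣≡∣q-p∣ (seq x n) (seq y n))) (x≈y ε)

≈ᴿ-trans : ∀ x y z → x ≈ᴿ y → y ≈ᴿ z → x ≈ᴿ z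
≈ᴿ-trans x y z x≈y y≈z ε = eventually-map step (x≈y (½ ℚ.* ε) and y≈z (½ ℚ.* ε))
  where
  instance
    ½ε-pos : Positive (½ ℚ.* ε)
    ½ε-pos = ℚ.pos*pos⇒pos ½ ε
  step : ∀ {n} → ∣ seq x n ℚ.- seq y n ∣ ℚ.< ½ ℚ.* ε × ∣ seq y n ℚ.- seq z n ∣ ℚ.< ½ ℚ.* ε →
         ∣ seq x n ℚ.- seq z n ∣ ℚ.< ε
  step {n} (xy , yz) = begin-strict
    ∣ p ℚ.- r ∣                      ≡⟨ cong ∣_∣ (telescope p q r) ⟨
    ∣ (p ℚ.- q) ℚ.+ (q ℚ.- r) ∣      ≤⟨ ℚ.∣p+q∣≤∣p∣+∣q∣ (p ℚ.- q) (q ℚ.- r) ⟩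
    ∣ p ℚ.- q ∣ ℚ.+ ∣ q ℚ.- r ∣      <⟨ ℚ.+-mono-< xy yz ⟩
    ½ ℚ.* ε ℚ.+ ½ ℚ.* ε              ≡⟨ ℚ.*-distribʳ-+ ε ½ ½ ⟨
    1ℚ ℚ.* ε                         ≡⟨ ℚ.*-identityˡ ε ⟩
    ε                                ∎
    where
    open ℚ.≤-Reasoning
    p = seq x n
    q = seq y n
    r = seq z n

*ᴿ-cong : ∀ x x′ y y′ → x ≈ᴿ x′ → y ≈ᴿ y′ → x *ᴿ y ≈ᴿ x′ *ᴿ y′
*ᴿ-cong x x′ y y′ x≈x′ y≈y′ ε with bound x | bound y′
-- `*-close` passes through the mixed product of `x` and `y′`, hence bounds on exactly these two.
... | A , A-pos , x≤A | B , B-pos , y′≤B =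
  eventually-map step (x≤A and y′≤B and x≈x′ δ and y≈y′ δ)
  where
  instance
    _ = A-pos
    _ = B-pos
    A+B-pos : Positive (A ℚ.+ B)
    A+B-pos = ℚ.pos+pos⇒pos A B
    A+B-nonZero : ℚ.NonZero (A ℚ.+ B)
    A+B-nonZero = ℚ.pos⇒nonZero (A ℚ.+ B)
  δ : ℚ
  -- Chosen so that the error `(A + B) * δ` of `*-close` equals `ε`.
  δ = ℚ.1/ (A ℚ.+ B) ℚ.* ε
  instance
    δ-pos : Positive δ
    δ-pos = ℚ.pos*pos⇒pos (ℚ.1/ (A ℚ.+ B)) {{ℚ.1/pos⇒pos (A ℚ.+ B)}} ε
  step : ∀ {n} →
    ∣ seq x n ∣ ℚ.≤ A × ∣ seq y′ n ∣ ℚ.≤ B ×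
    ∣ seq x n ℚ.- seq x′ n ∣ ℚ.< δ × ∣ seq y n ℚ.- seq y′ n ∣ ℚ.< δ →
    ∣ seq (x *ᴿ y) n ℚ.- seq (x′ *ᴿ y′) n ∣ ℚ.< ε
  step {n} (x≤A , y′≤B , xx′ , yy′) =
    subst (∣ seq (x *ᴿ y) n ℚ.- seq (x′ *ᴿ y′) n ∣ ℚ.<_) (cancel-1/ (A ℚ.+ B) ε)
      (*-close A B {seq x n} {seq y n} {seq x′ n} {seq y′ n} x≤A y′≤B xx′ yy′)

eventually-positive : ∀ x → 0ℝ <ᴿ x → Eventually (λ n → 0ℚ ℚ.< seq x n)
eventually-positive x (ε , ε-pos , x≥ε) = eventually-map
  (λ {n} ε≤x → ℚ.<-≤-trans (ℚ.positive⁻¹ ε {{ε-pos}}) (subst (ℚ._≤ seq x n) (ℚ.+-identityˡ ε) ε≤x))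
  x≥ε

infix 8 _⁻¹

-- With this choice `x ÷ y` unfolds to `x · y ⁻¹`, so the abstract `Quotient` coincides with the
-- formula written with `÷`.
_⁻¹ : ℝ₊* → ℝ₊*
x ⁻¹ = recipᴿ (value x) (value>0 x) , recipᴿ-positive (value x) (value>0 x)

·-inverseʳ : ∀ x → x · x ⁻¹ ≈ 𝟙
·-inverseʳ x = ≈ᴿ-reflexive (value (x · x ⁻¹)) 1ℝ
  (eventually-map recip-inverse (eventually-positive (value x) (value>0 x)))

≈-reflexive : ∀ x y → (∀ n → seq (value x) n ≡ seq (value y) n) → x ≈ y
≈-reflexive x y x≡y = ≈ᴿ-reflexive (value x) (value y) (0 , λ n _ → x≡y n)

≈-refl : ∀ x → x ≈ x
≈-refl x = ≈-reflexive x x (λ _ → ≡.refl)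

·-commutativeMonoid : CommutativeMonoid 0ℓ 0ℓ
·-commutativeMonoid = record
  { Carrier = ℝ₊*
  ; _≈_ = _≈_
  ; _∙_ = _·_
  ; ε = 𝟙
  ; isCommutativeMonoid = record
    { isMonoid = record
      { isSemigroup = record
        { isMagma = record
          { isEquivalence = record
            { refl  = λ {x} → ≈-refl x
            ; sym   = λ {x} {y} → ≈ᴿ-sym (value x) (value y)
            ; trans = λ {x} {y} {z} → ≈ᴿ-trans (value x) (value y) (value z)
            }
          ; ∙-cong = λ {x} {x′} {y} {y′} →
              *ᴿ-cong (value x) (value x′) (value y) (value y′)
          }
        ; assoc = λ x y z → ≈-reflexive (x · y · z) (x · (y · z))
            (λ n → ℚ.*-assoc (seq (value x) n) (seq (value y) n) (seq (value z) n))
        }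
      ; identity =
          (λ x → ≈-reflexive (𝟙 · x) x (λ n → ℚ.*-identityˡ (seq (value x) n))) ,
          (λ x → ≈-reflexive (x · 𝟙) x (λ n → ℚ.*-identityʳ (seq (value x) n)))
      }
    ; comm = λ x y → ≈-reflexive (x · y) (y · x)
        (λ n → ℚ.*-comm (seq (value x) n) (seq (value y) n))
    }
  }

·-abelianGroup : AbelianGroup 0ℓ 0ℓ
·-abelianGroup = commutativeMonoid+inverse⇒abelianGroup ·-commutativeMonoid _⁻¹ ·-inverseʳ

-- Passage between functions off the origin and functions on all pairs.

open Multinomial ·-abelianGroup

proposition5 : (f₁ f₂ : ℕ²∖0 → ℝ₊*) →
    ( (∀ n → n ≥ 1 →
    (f₁ ⟨ n , 0 ⟩ ≈ 𝟙 × f₁ ⟨ 0 , n ⟩ ≈ 𝟙) ×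
    (f₂ ⟨ n , 0 ⟩ ≈ 𝟙 × f₂ ⟨ 0 , n ⟩ ≈ 𝟙))
    × (∀ ν₀ ν₁ ν₂ → ν₀ + ν₁ + ν₂ ≢ 0 →
    f₁ ⟨ ν₀ + ν₂ , ν₁ ⟩ · f₂ ⟨ ν₀ , ν₂ ⟩ ≈ f₂ ⟨ ν₀ + ν₁ , ν₂ ⟩ · f₁ ⟨ ν₀ , ν₁ ⟩))
    ⇔
    (∃ λ (D : Sequence) → D 1 ≈ 𝟙 ×
    (∀ ν₁ ν₂ → (ν₁ , ν₂) ≢ (0 , 0) →
    f₁ ⟨ ν₁ , ν₂ ⟩ ≈ f₂ ⟨ ν₁ , ν₂ ⟩ ×
    f₂ ⟨ ν₁ , ν₂ ⟩ ≈ [ ν₁ + ν₂ ] D ! ÷ ([ ν₁ ] D ! · [ ν₂ ] D !)))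
proposition5 f₁ f₂ = mk⇔
  -- `sequence 1` unfolds to `g₂ 0 1`, so its normalisation is the unit condition at `n = 1`.
  (λ (unit , exchange) → sequence , g₂-0ˡ unit 1 , λ a b _ →
    exchange⇒quotient {g₁} {g₂} (g₁-0ˡ unit) (g₂-0ˡ unit) (exchange-everywhere exchange)
      {[_] sequence !} (≈-refl 𝟙) (λ n → ≈-refl (g₂ n 1 · [ n ] sequence !)) a b)
  (λ (D , _ , formula) →
    let open Backward D formula in
    (λ n _ → (quotient⇒0ʳ {F} {g₁} (≈-refl 𝟙) g₁-quotient n ,
              quotient⇒0ˡ {F} {g₁} (≈-refl 𝟙) g₁-quotient n) ,
             (quotient⇒0ʳ {F} {g₂} (≈-refl 𝟙) g₂-quotient n ,
              quotient⇒0ˡ {F} {g₂} (≈-refl 𝟙) g₂-quotient n)) ,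
    λ a b c _ → quotient⇒exchange {F} {g₁} {g₂} g₁-quotient g₂-quotient a b c)
  where
  g₁ g₂ : ℕ → ℕ → ℝ₊*
  g₁ a b = f₁ ⟨ a , b ⟩
  g₂ a b = f₂ ⟨ a , b ⟩

  -- Because of `pred`, `sequence (suc n)` computes to `g₂ n 1`; the factorial recursion for `F`
  -- then holds by reflexivity.
  sequence : Sequence
  sequence i = g₂ (ℕ.pred i) 1

  module _ (unit : ∀ n → n ≥ 1 → (g₁ n 0 ≈ 𝟙 × g₁ 0 n ≈ 𝟙) × (g₂ n 0 ≈ 𝟙 × g₂ 0 n ≈ 𝟙)) where
    g₁-0ˡ : ∀ n → g₁ 0 n ≈ 𝟙
    g₁-0ˡ zero    = ≈-refl 𝟙
    g₁-0ˡ (suc n) = proj₂ (proj₁ (unit (suc n) (s≤s z≤n)))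

    g₂-0ˡ : ∀ n → g₂ 0 n ≈ 𝟙
    g₂-0ˡ zero    = ≈-refl 𝟙
    g₂-0ˡ (suc n) = proj₂ (proj₂ (unit (suc n) (s≤s z≤n)))

  -- At the origin the convention turns both sides into `𝟙 · 𝟙`. In the other cases the split
  -- exposes a successor in the sum, which refutes its being zero.
  exchange-everywhere :
    (∀ a b c → a + b + c ≢ 0 → g₁ (a + c) b · g₂ a c ≈ g₂ (a + b) c · g₁ a b) →
    Exchange g₁ g₂
  exchange-everywhere exchange zero    zero    zero    = ≈-refl (𝟙 · 𝟙)
  exchange-everywhere exchange zero    zero    (suc c) = exchange 0 0 (suc c) λ ()
  exchange-everywhere exchange zero    (suc b) c       = exchange 0 (suc b) c λ ()
  exchange-everywhere exchange (suc a) b       c       = exchange (suc a) b c λ ()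

  module Backward (D : Sequence) (formula : ∀ a b → (a , b) ≢ (0 , 0) →
      g₁ a b ≈ g₂ a b × g₂ a b ≈ [ a + b ] D ! ÷ ([ a ] D ! · [ b ] D !)) where
    F : ℕ → ℝ₊*
    F n = [ n ] D !

    -- At the origin the convention agrees with the formula: every term of `𝟙 ÷ (𝟙 · 𝟙)` evaluates
    -- to the rational 1.
    extend : ∀ f → (∀ a b → (a , b) ≢ (0 , 0) → f ⟨ a , b ⟩ ≈ F (a + b) ÷ (F a · F b)) →
             Quotient F (f ⟨_,_⟩)
    extend f eq zero    zero    = ≈-reflexive 𝟙 (𝟙 ÷ (𝟙 · 𝟙)) (λ _ → ≡.refl)
    extend f eq zero    (suc b) = eq 0 (suc b) λ ()
    extend f eq (suc a) b       = eq (suc a) b λ ()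

    g₂-quotient : Quotient F g₂
    g₂-quotient = extend f₂ λ a b ≢0 → proj₂ (formula a b ≢0)

    g₁-quotient : Quotient F g₁
    g₁-quotient = extend f₁ λ a b ≢0 → let g₁≈g₂ , g₂≈quotient = formula a b ≢0 in
      ≈ᴿ-trans (value (g₁ a b)) (value (g₂ a b)) (value (F (a + b) ÷ (F a · F b)))
        g₁≈g₂ g₂≈quotient
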